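{- Let $n$ be a positive integer and let $A(n)=(a_{ij})_{i,j\in\mathbb{N}}$ be the greedy matrix described in the context. Then $A(n)$ is symmetric: $a_{ij}=a_{ji}$ for all $i,j\geq 1$.
   Context: $\mathbb{N}=\{1,2,3,\dots\}$. Fix a positive integer $n$. The infinite $\{0,1\}$-matrix $A(n)=(a_{ij})_{i,j\in\mathbb{N}}$ is defined recursively. Its entries are determined row by row (row $1$ first), and within each row from left to right, so that $a_{kl}$ is determined after all $a_{ij}$ with $i<k$ and all $a_{kj}$ with $j<l$. One sets $a_{kl}=1$ if and only if all of the following hold: (1) $\sum_{j<l}a_{kj}<n+1$; (2) $\sum_{i<k}a_{il}<n+1$; (3) there is no pair $(i,j)$ with $1\le i<k$, $1\le j<l$ and $a_{ij}=a_{il}=a_{kj}=1$. Otherwise $a_{kl}=0$. -}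

module Defs where

open import Data.Bool.Base using (if_then_else_)
open import Data.Fin.Base using (Fin; toℕ)
open import Data.Fin.Properties using (any?; toℕ<n)
open import Data.Nat.Base using (ℕ; _+_; _<_)
open import Data.Nat.Induction using (<-wellFounded)
open import Data.Nat.Properties using (_≟_; _<?_; +-0-monoid)
open import Algebra.Properties.Monoid.Sum +-0-monoid using (sum; sum-cong-≗)
open import Data.Product.Base using (_×_; _,_; ∃₂)
open import Data.Product.Relation.Binary.Lex.Strict using (×-Lex; ×-wellFounded)
open import Data.Sum.Base using (_⊎_; inj₁; inj₂)
open import Data.Vec.Functional using (Vector)
open import Function.Bundles using (_⇔_; mk⇔)
open import Induction.WellFounded using (WellFounded; WfRec; module All; module FixPoint)
open import Level using (0ℓ)
open import Relation.Binary.PropositionalEquality using (_≡_; refl; sym; trans; cong; subst)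
open import Relation.Nullary using (¬_; Dec; yes; no; does; contradiction)
open import Relation.Nullary.Decidable using (¬?; _×-dec_; does-⇔)

-- Rows and columns are numbered from 0 throughout: the pair (i , j) of
-- naturals stands for the position (i+1, j+1) of the matrix.

-- The order in which entries are determined: row by row, and from left to
-- right within a row.
_≺_ : ℕ × ℕ → ℕ × ℕ → Set
_≺_ = ×-Lex _≡_ _<_ _<_

-- Opaque so that the type checker does not unfold the recursion below;
-- use A-unfold instead.
opaque
  ≺-wellFounded : WellFounded _≺_
  ≺-wellFounded = ×-wellFounded <-wellFounded <-wellFounded

-- The condition for a 1 at position (k , l), as a function of the entries
-- left j = a k j, above i = a i l and block i j = a i j for i < k, j < l.
Allowed : (n : ℕ) {k l : ℕ} →
          Vector ℕ l → Vector ℕ k → (Fin k → Fin l → ℕ) → Set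
Allowed n left above block =
  sum left < n + 1 ×
  sum above < n + 1 ×
  ¬ (∃₂ λ i j → block i j ≡ 1 × above i ≡ 1 × left j ≡ 1)

allowed? : (n : ℕ) {k l : ℕ}
           (left : Vector ℕ l) (above : Vector ℕ k) (block : Fin k → Fin l → ℕ) →
           Dec (Allowed n left above block)
allowed? n left above block =
  (sum left <? n + 1) ×-dec
  (sum above <? n + 1) ×-dec
  ¬? (any? λ i → any? λ j → (block i j ≟ 1) ×-dec (above i ≟ 1) ×-dec (left j ≟ 1))

entry : (n : ℕ) {k l : ℕ} →
        Vector ℕ l → Vector ℕ k → (Fin k → Fin l → ℕ) → ℕ
entry n left above block = if does (allowed? n left above block) then 1 else 0

greedyStep : (n : ℕ) (p : ℕ × ℕ) → WfRec _≺_ (λ _ → ℕ) p → ℕ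
greedyStep n (k , l) prev = entry n {k} {l}
  (λ j → prev {k , toℕ j} (inj₂ (refl , toℕ<n j)))
  (λ i → prev {toℕ i , l} (inj₁ (toℕ<n i)))
  (λ i j → prev {toℕ i , toℕ j} (inj₁ (toℕ<n i)))

-- The matrix A(n).
A : ℕ → ℕ → ℕ → ℕ
A n i j = All.wfRec ≺-wellFounded 0ℓ (λ _ → ℕ) (greedyStep n) (i , j)

-- The remainder checks that A satisfies its defining recursion.

private
  Allowed-resp : ∀ n {k l} {left left′ : Vector ℕ l} {above above′ : Vector ℕ k}
                 {block block′ : Fin k → Fin l → ℕ} →
                 (∀ j → left j ≡ left′ j) → (∀ i → above i ≡ above′ i) →
                 (∀ i j → block i j ≡ block′ i j) →
                 Allowed n left above block → Allowed n left′ above′ block′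
  Allowed-resp n l≗ a≗ b≗ (r , c , ¬rect) =
    subst (_< n + 1) (sum-cong-≗ l≗) r ,
    subst (_< n + 1) (sum-cong-≗ a≗) c ,
    λ (i , j , b , a , l) →
      ¬rect (i , j , trans (b≗ i j) b , trans (a≗ i) a , trans (l≗ j) l)

  entry-cong : ∀ n {k l} {left left′ : Vector ℕ l} {above above′ : Vector ℕ k}
               {block block′ : Fin k → Fin l → ℕ} →
               (∀ j → left j ≡ left′ j) → (∀ i → above i ≡ above′ i) →
               (∀ i j → block i j ≡ block′ i j) →
               entry n left above block ≡ entry n left′ above′ block′
  entry-cong n {left = left} {left′} {above} {above′} {block} {block′} l≗ a≗ b≗ =
    cong (if_then 1 else 0) (does-⇔
      (mk⇔ (Allowed-resp n {left = left} {left′} {above} {above′} {block} {block′} l≗ a≗ b≗)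
           (Allowed-resp n {left = left′} {left} {above′} {above} {block′} {block}
              (λ j → sym (l≗ j)) (λ i → sym (a≗ i)) (λ i j → sym (b≗ i j))))
      (allowed? n left above block) (allowed? n left′ above′ block′))

  greedyStep-ext : ∀ n p {prev prev′ : WfRec _≺_ (λ _ → ℕ) p} →
                   (∀ {q} q≺p → prev {q} q≺p ≡ prev′ q≺p) →
                   greedyStep n p prev ≡ greedyStep n p prev′
  greedyStep-ext n (k , l) eq = entry-cong n
    (λ j → eq (inj₂ (refl , toℕ<n j)))
    (λ i → eq (inj₁ (toℕ<n i)))
    (λ i j → eq (inj₁ (toℕ<n i)))

  indicator-0-1 : {P : Set} (P? : Dec P) →
                  (if does P? then 1 else 0) ≡ 0 ⊎ (if does P? then 1 else 0) ≡ 1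
  indicator-0-1 (no _)  = inj₁ refl
  indicator-0-1 (yes _) = inj₂ refl

  indicator≡1⇔ : {P : Set} (P? : Dec P) → (if does P? then 1 else 0) ≡ 1 ⇔ P
  indicator≡1⇔ (yes p) = mk⇔ (λ _ → p) (λ _ → refl)
  indicator≡1⇔ (no ¬p) = mk⇔ (λ ()) (λ p → contradiction p ¬p)

AllowedAt : ℕ → ℕ → ℕ → Set
AllowedAt n k l = Allowed n {k} {l}
  (λ j → A n k (toℕ j)) (λ i → A n (toℕ i) l) (λ i j → A n (toℕ i) (toℕ j))

allowedAt? : ∀ n k l → Dec (AllowedAt n k l)
allowedAt? n k l = allowed? n {k} {l}
  (λ j → A n k (toℕ j)) (λ i → A n (toℕ i) l) (λ i j → A n (toℕ i) (toℕ j))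

A-unfold : ∀ n k l → A n k l ≡ (if does (allowedAt? n k l) then 1 else 0)
A-unfold n k l =
  FixPoint.unfold-wfRec ≺-wellFounded (λ _ → ℕ) (greedyStep n) (greedyStep-ext n) {k , l}

A-0-1 : ∀ n k l → A n k l ≡ 0 ⊎ A n k l ≡ 1
A-0-1 n k l =
  subst (λ x → x ≡ 0 ⊎ x ≡ 1) (sym (A-unfold n k l)) (indicator-0-1 (allowedAt? n k l))

A≡1⇔AllowedAt : ∀ n k l → A n k l ≡ 1 ⇔ AllowedAt n k l
A≡1⇔AllowedAt n k l =
  subst (λ x → x ≡ 1 ⇔ AllowedAt n k l) (sym (A-unfold n k l)) (indicator≡1⇔ (allowedAt? n k l))

{-# OPTIONS --safe #-}
module Submission where

-- Conditions (1) and (2) are exchanged by transposition and (3) is invariant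
-- under it, so symmetry propagates along the order in which the entries are
-- determined.

open import Defs
open import Data.Bool.Base using (if_then_else_)
open import Data.Fin.Base using (Fin)
open import Data.Fin.Properties using (toℕ<n)
open import Data.Nat.Base using (ℕ; _+_; _<_; NonZero)
open import Data.Nat.Properties using (+-0-monoid)
open import Algebra.Properties.Monoid.Sum +-0-monoid using (sum-cong-≗)
open import Data.Product.Base using (_×_; _,_)
open import Data.Sum.Base using (inj₁; inj₂)
open import Data.Vec.Functional using (Vector)
open import Function.Bundles using (mk⇔)
open import Induction.WellFounded using (WfRec; module All)
open import Level using (0ℓ)
open import Relation.Binary.PropositionalEquality using (_≡_; refl; sym; trans; cong; subst; module ≡-Reasoning)
open import Relation.Nullary using (does)
open import Relation.Nullary.Decidable using (does-⇔)

-- The rule for the entry at `(k , l)` reads its row to the left, its column above and the block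
-- between them. If symmetry holds at those positions, they are the transposes of the data read at
-- `(l , k)`, so both entries get the same verdict. Well-founded induction along `_≺_` finishes.

Allowed-transpose : ∀ n {k l}
  {left : Vector ℕ l} {above : Vector ℕ k} {block : Fin k → Fin l → ℕ}
  {left′ : Vector ℕ k} {above′ : Vector ℕ l} {block′ : Fin l → Fin k → ℕ} →
  (∀ j → left j ≡ above′ j) → (∀ i → above i ≡ left′ i) →
  (∀ i j → block i j ≡ block′ j i) →
  Allowed n left above block → Allowed n left′ above′ block′
Allowed-transpose n l≗ a≗ b≗ (row , col , ¬rect) =
  subst (_< n + 1) (sum-cong-≗ a≗) col ,
  subst (_< n + 1) (sum-cong-≗ l≗) row ,
  -- A forbidden rectangle of the transposed data is reflected in the diagonal: its two arms trade
  -- places.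
  λ (j , i , b , a , l) →
    ¬rect (i , j , trans (b≗ i j) b , trans (a≗ i) l , trans (l≗ j) a)

SymmetricAt : ℕ → ℕ × ℕ → Set
SymmetricAt n (k , l) = A n k l ≡ A n l k

-- Although `_≺_` is not invariant under transposition, it suffices that the positions read at
-- `(k , l)` precede it: the hypothesis there also determines their mirror images, which may come
-- later.
symmetricAt-step : ∀ n p → WfRec _≺_ (SymmetricAt n) p → SymmetricAt n p
symmetricAt-step n (k , l) ih = begin
  A n k l                                       ≡⟨ A-unfold n k l ⟩
  (if does (allowedAt? n k l) then 1 else 0)    ≡⟨ cong (if_then 1 else 0) does≡ ⟩
  (if does (allowedAt? n l k) then 1 else 0)    ≡⟨ A-unfold n l k ⟨
  A n l k                                       ∎
  where
  open ≡-Reasoning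
  left≗ = λ (j : Fin l) → ih (inj₂ (refl , toℕ<n j))
  above≗ = λ (i : Fin k) → ih (inj₁ (toℕ<n i))
  block≗ = λ (i : Fin k) (j : Fin l) → ih (inj₁ (toℕ<n i))
  does≡ = does-⇔
    (mk⇔ (Allowed-transpose n left≗ above≗ block≗)
         -- The converse is the same lemma, since transposing twice restores the data.
         (Allowed-transpose n (λ i → sym (above≗ i)) (λ j → sym (left≗ j))
            (λ j i → sym (block≗ i j))))
    (allowedAt? n k l) (allowedAt? n l k)

theorem3p2 : (n : ℕ) .{{_ : NonZero n}} (i j : ℕ) → A n i j ≡ A n j i
theorem3p2 n i j =
  All.wfRec ≺-wellFounded 0ℓ (SymmetricAt n) (symmetricAt-step n) (i , j)
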